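{- Let $m$ be a positive integer and let $a_1,a_2,K$ be integers with $0\le a_1,a_2,K\le m-1$. Then $$0\le S_m(\{a_1,a_2\},K).$$
   Context: For a positive integer $m$ and non-negative integers $a_1,a_2,K$ (with $a_1=a_2$ allowed; $\{a_1,a_2\}$ is just a list of parameters), define $$S_m(\{a_1,a_2\},K)=\sum_{k=0}^K\left(\left\lfloor\frac{a_1+a_2+k}{m}\right\rfloor-\left\lfloor\frac{a_1+k}{m}\right\rfloor-\left\lfloor\frac{a_2+k}{m}\right\rfloor+\left\lfloor\frac{k}{m}\right\rfloor\right).$$ -}

module Defs where

open import Data.Fin.Base using (toℕ)
open import Data.Integer.Base using (ℤ; +_; _+_; _-_)
open import Data.Integer.Properties using (+-0-commutativeMonoid)
open import Data.Nat.Base as ℕ using (ℕ; NonZero)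

open import Algebra.Properties.CommutativeMonoid.Sum +-0-commutativeMonoid
  using (sum⁺-syntax)

-- The numerators are natural numbers, so ℕ._/_ is the floor of the quotient;
-- the floors are combined in ℤ, because a summand may be negative.
S : (m : ℕ) .{{_ : NonZero m}} (a₁ a₂ K : ℕ) → ℤ
S m a₁ a₂ K = ∑[ k ≤ K ] summand (toℕ k)
  where
  summand : ℕ → ℤ
  summand k =
    + ((a₁ ℕ.+ a₂ ℕ.+ k) ℕ./ m) - + ((a₁ ℕ.+ k) ℕ./ m)
      - + ((a₂ ℕ.+ k) ℕ./ m) + + (k ℕ./ m)

{-# OPTIONS --safe #-}
-- Let G be the summatory function of ⌊·/m⌋ and n = K + 1.  Telescoping gives
--   S = G(a+b+n) − G(a+b) − G(a+n) − G(b+n) + G(a) + G(b) + G(n),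
-- where the last three terms are nonnegative.  G is piecewise linear: it equals
-- x ∸ m up to 2m, and everywhere it dominates both x − m and 2x − 3m.  If
-- a+b, a+n, b+n all exceed m, the second bound gives the claim; otherwise one of
-- the three truncated differences vanishes and the first bound suffices.
module Submission where

open import Defs
open import Data.Integer.Base using (0ℤ) renaming (_≤_ to _≤ℤ_)
open import Data.Nat.Base using (ℕ; NonZero; _≤_; _∸_)

import Data.Integer.Base as ℤ
import Data.Integer.Properties as ℤ
open import Data.Integer.Tactic.RingSolver using (solve-∀)
open import Data.Fin.Base using (toℕ)
open import Data.Nat.Base using (zero; suc; _+_; _*_; _/_; z≤n; s≤s)
open import Data.Nat.DivMod using (m<n⇒m/n≡0; m≥n⇒m/n>0; m*n/n≡m; /-monoˡ-≤; m<n*o⇒m/o<n)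
open import Data.Nat.Properties
open import Data.Nat.Tactic.RingSolver using () renaming (solve-∀ to solveℕ-∀)
open import Data.Sum.Base using (inj₁; inj₂)
open import Relation.Binary.PropositionalEquality

open import Algebra.Properties.CommutativeMonoid.Sum ℤ.+-0-commutativeMonoid
  using (sum; sum-cong-≗)

-- The summatory function with exclusive upper limit, so that its increment at `x` is `x / m` by
-- computation.
floorSum : (m : ℕ) .{{_ : NonZero m}} → ℕ → ℕ
floorSum m zero    = 0
floorSum m (suc x) = x / m + floorSum m x

module _ (m : ℕ) .{{_ : NonZero m}} where

  private G = floorSum m

  -- From `m` on, every increment of `G` is at least 1.
  x≤m+floorSum : ∀ x → x ≤ m + G x
  x≤m+floorSum zero = z≤n
  x≤m+floorSum (suc x) with <-≤-connex x m
  ... | inj₁ x<m = ≤-trans x<m (m≤m+n m _)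
  ... | inj₂ m≤x = begin
    1 + x               ≤⟨ +-mono-≤ (m≥n⇒m/n>0 m≤x) (x≤m+floorSum x) ⟩
    x / m + (m + G x)   ≡⟨ swap (x / m) m (G x) ⟩
    m + (x / m + G x)   ∎
    where
    open ≤-Reasoning
    swap : ∀ p q r → p + (q + r) ≡ q + (p + r)
    swap = solveℕ-∀

  2x≤3m+floorSum : ∀ x → 2 * x ≤ 3 * m + G x
  2x≤3m+floorSum zero = z≤n
  2x≤3m+floorSum (suc x) with <-≤-connex x (2 * m)
  -- Here `suc x ≤ 2 * m`, so adding the slope-one bound at `suc x` suffices without induction;
  -- beyond `2 * m` each increment is at least 2.
  ... | inj₁ x<2m = begin
    2 * suc x                  ≡⟨ double (suc x) ⟩
    suc x + suc x              ≤⟨ +-mono-≤ x<2m (x≤m+floorSum (suc x)) ⟩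
    2 * m + (m + G (suc x))    ≡⟨ regroup m (G (suc x)) ⟩
    3 * m + G (suc x)          ∎
    where
    open ≤-Reasoning
    double : ∀ p → 2 * p ≡ p + p
    double = solveℕ-∀
    regroup : ∀ p q → 2 * p + (p + q) ≡ 3 * p + q
    regroup = solveℕ-∀
  ... | inj₂ 2m≤x = begin
    2 * suc x                  ≡⟨ *-suc 2 x ⟩
    2 + 2 * x                  ≤⟨ +-mono-≤ 2≤x/m (2x≤3m+floorSum x) ⟩
    x / m + (3 * m + G x)      ≡⟨ swap (x / m) m (G x) ⟩
    3 * m + (x / m + G x)      ∎
    where
    open ≤-Reasoning
    2≤x/m : 2 ≤ x / m
    2≤x/m = subst (_≤ x / m) (m*n/n≡m 2 m) (/-monoˡ-≤ m 2m≤x)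
    swap : ∀ p q r → p + (3 * q + r) ≡ 3 * q + (p + r)
    swap = solveℕ-∀

  -- The increments of `G` are 0 below `m` and 1 from `m` up to `2 * m`.
  floorSum≤x∸m : ∀ x → x ≤ 2 * m → G x ≤ x ∸ m
  floorSum≤x∸m zero _ = z≤n
  floorSum≤x∸m (suc x) x<2m with <-≤-connex x m
  ... | inj₁ x<m = begin
    x / m + G x     ≡⟨ cong (_+ G x) (m<n⇒m/n≡0 x<m) ⟩
    G x             ≤⟨ floorSum≤x∸m x (<⇒≤ x<2m) ⟩
    x ∸ m           ≤⟨ ∸-monoˡ-≤ m (n≤1+n x) ⟩
    suc x ∸ m       ∎
    where open ≤-Reasoning
  ... | inj₂ m≤x = begin
    x / m + G x     ≤⟨ +-mono-≤ (≤-pred (m<n*o⇒m/o<n x<2m)) (floorSum≤x∸m x (<⇒≤ x<2m)) ⟩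
    1 + (x ∸ m)     ≡⟨ +-∸-assoc 1 m≤x ⟨
    suc x ∸ m       ∎
    where open ≤-Reasoning

∸-superadditive : ∀ b c d → (b ∸ d) + (c ∸ d) ≤ (b + c) ∸ d
∸-superadditive b c d with ≤-total b d
... | inj₁ b≤d = begin
  (b ∸ d) + (c ∸ d)   ≡⟨ cong (_+ (c ∸ d)) (m≤n⇒m∸n≡0 b≤d) ⟩
  c ∸ d               ≤⟨ ∸-monoˡ-≤ d (m≤n+m c b) ⟩
  (b + c) ∸ d         ∎
  where open ≤-Reasoning
... | inj₂ d≤b = begin
  (b ∸ d) + (c ∸ d)   ≤⟨ +-monoʳ-≤ (b ∸ d) (m∸n≤m c d) ⟩
  (b ∸ d) + c         ≡⟨ +-∸-comm c d≤b ⟨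
  (b + c) ∸ d         ∎
  where open ≤-Reasoning

∸-superadditive-overlap : ∀ {m a} b c → a ≤ m →
  (a + b ∸ m) + (a + c ∸ m) ≤ a + b + c ∸ m
∸-superadditive-overlap {m} {a} b c a≤m =
  -- Writing `m` as `a + d` cancels the shared summand `a` from all three differences.
  subst (λ t → (a + b ∸ t) + (a + c ∸ t) ≤ a + b + c ∸ t) (m+[n∸m]≡n a≤m) (begin
    (a + b ∸ (a + d)) + (a + c ∸ (a + d))  ≡⟨ cong₂ _+_ ([m+n]∸[m+o]≡n∸o a b d) ([m+n]∸[m+o]≡n∸o a c d) ⟩
    (b ∸ d) + (c ∸ d)                      ≤⟨ ∸-superadditive b c d ⟩
    (b + c) ∸ d                            ≡⟨ [m+n]∸[m+o]≡n∸o a (b + c) d ⟨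
    a + (b + c) ∸ (a + d)                  ≡⟨ cong (_∸ (a + d)) (+-assoc a b c) ⟨
    a + b + c ∸ (a + d)                    ∎)
  where
  open ≤-Reasoning
  d = m ∸ a

module _ (m : ℕ) .{{_ : NonZero m}} where

  private G = floorSum m

  overlap≤floorSum : ∀ {a} b c → a ≤ m →
    (a + b ∸ m) + (a + c ∸ m) ≤ G (a + b + c)
  overlap≤floorSum {a} b c a≤m =
    ≤-trans (∸-superadditive-overlap b c a≤m)
            (m≤n+o⇒m∸n≤o (a + b + c) m (x≤m+floorSum m (a + b + c)))

  -- When one pair sum is at most `m`, its term vanishes and the other two pairs share a summand;
  -- the permutations below bring that summand to the front for `overlap≤floorSum`.
  pairs≤floorSum : ∀ {a b c} → a ≤ m → b ≤ m → c ≤ m →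
    (a + b ∸ m) + (a + c ∸ m) + (b + c ∸ m) ≤ G (a + b + c)
  pairs≤floorSum {a} {b} {c} a≤m b≤m c≤m
    with ≤-total (b + c) m | ≤-total (a + c) m | ≤-total (a + b) m
  ... | inj₁ bc≤m | _ | _ = begin
    p + q + r   ≡⟨ cong (p + q +_) (m≤n⇒m∸n≡0 bc≤m) ⟩
    p + q + 0   ≡⟨ +-identityʳ (p + q) ⟩
    p + q       ≤⟨ overlap≤floorSum b c a≤m ⟩
    G (a + b + c) ∎
    where
    open ≤-Reasoning
    p = a + b ∸ m
    q = a + c ∸ m
    r = b + c ∸ m
  ... | inj₂ _ | inj₁ ac≤m | _ = begin
    p + q + r         ≡⟨ cong (λ t → p + t + r) (m≤n⇒m∸n≡0 ac≤m) ⟩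
    p + 0 + r         ≡⟨ cong (_+ r) (+-identityʳ p) ⟩
    p + r             ≡⟨ cong (λ t → t ∸ m + r) (+-comm a b) ⟩
    (b + a ∸ m) + r   ≤⟨ overlap≤floorSum a c b≤m ⟩
    G (b + a + c)     ≡⟨ cong (λ t → G (t + c)) (+-comm b a) ⟩
    G (a + b + c)     ∎
    where
    open ≤-Reasoning
    p = a + b ∸ m
    q = a + c ∸ m
    r = b + c ∸ m
  ... | inj₂ _ | inj₂ _ | inj₁ ab≤m = begin
    p + q + r                   ≡⟨ cong (λ t → t + q + r) (m≤n⇒m∸n≡0 ab≤m) ⟩
    q + r                       ≡⟨ cong₂ (λ s t → s ∸ m + (t ∸ m)) (+-comm a c) (+-comm b c) ⟩
    (c + a ∸ m) + (c + b ∸ m)   ≤⟨ overlap≤floorSum a b c≤m ⟩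
    G (c + a + b)               ≡⟨ cong G (rotate a b c) ⟩
    G (a + b + c)               ∎
    where
    open ≤-Reasoning
    p = a + b ∸ m
    q = a + c ∸ m
    r = b + c ∸ m
    rotate : ∀ a b c → c + a + b ≡ a + b + c
    rotate = solveℕ-∀
  -- No difference is truncated, so adding `3 * m` restores the three pair sums, which total
  -- `2 * (a + b + c)`.
  ... | inj₂ m≤bc | inj₂ m≤ac | inj₂ m≤ab = +-cancelˡ-≤ (3 * m) _ _ (begin
    3 * m + (p + q + r)                 ≡⟨ distribute m p q r ⟩
    (m + p) + (m + q) + (m + r)         ≡⟨ cong₂ _+_ (cong₂ _+_ (m+[n∸m]≡n m≤ab) (m+[n∸m]≡n m≤ac)) (m+[n∸m]≡n m≤bc) ⟩
    (a + b) + (a + c) + (b + c)         ≡⟨ double a b c ⟩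
    2 * (a + b + c)                     ≤⟨ 2x≤3m+floorSum m (a + b + c) ⟩
    3 * m + G (a + b + c)               ∎)
    where
    open ≤-Reasoning
    p = a + b ∸ m
    q = a + c ∸ m
    r = b + c ∸ m
    distribute : ∀ m p q r → 3 * m + (p + q + r) ≡ (m + p) + (m + q) + (m + r)
    distribute = solveℕ-∀
    double : ∀ a b c → (a + b) + (a + c) + (b + c) ≡ 2 * (a + b + c)
    double = solveℕ-∀

  floorSum-pairs : ∀ {a b c} → a ≤ m → b ≤ m → c ≤ m →
    G (a + b) + G (a + c) + G (b + c) ≤ G (a + b + c)
  floorSum-pairs a≤m b≤m c≤m = ≤-trans
    (+-mono-≤ (+-mono-≤ (bound a≤m b≤m) (bound a≤m c≤m)) (bound b≤m c≤m))
    (pairs≤floorSum a≤m b≤m c≤m)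
    where
    bound : ∀ {x y} → x ≤ m → y ≤ m → G (x + y) ≤ x + y ∸ m
    bound x≤m y≤m = floorSum≤x∸m m _
      (+-mono-≤ x≤m (≤-trans y≤m (≤-reflexive (sym (+-identityʳ m)))))

sum-telescope : ∀ (H : ℕ → ℤ.ℤ) n →
  sum {n} (λ k → H (suc (toℕ k)) ℤ.- H (toℕ k)) ≡ H n ℤ.- H 0
sum-telescope H zero    = sym (ℤ.+-inverseʳ (H 0))
sum-telescope H (suc n) = begin
  (H 1 ℤ.- H 0) ℤ.+ sum {n} (λ k → H (2 + toℕ k) ℤ.- H (1 + toℕ k))
    -- `sum` peels off its first term, so the induction runs on the shifted function.
    ≡⟨ cong (λ t → (H 1 ℤ.- H 0) ℤ.+ t) (sum-telescope (λ k → H (suc k)) n) ⟩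
  (H 1 ℤ.- H 0) ℤ.+ (H (suc n) ℤ.- H 1)
    ≡⟨ chain (H 0) (H 1) (H (suc n)) ⟩
  H (suc n) ℤ.- H 0 ∎
  where
  open ≡-Reasoning
  chain : ∀ x y z → (y ℤ.- x) ℤ.+ (z ℤ.- y) ≡ z ℤ.- x
  chain = solve-∀

module _ (m : ℕ) .{{_ : NonZero m}} (a b : ℕ) where

  private
    G : ℕ → ℤ.ℤ
    G x = ℤ.+ floorSum m x

  -- A discrete primitive of the summand of `S`: each floor is replaced by the summatory function
  -- `G`.
  antidifference : ℕ → ℤ.ℤ
  antidifference k = G (a + b + k) ℤ.- G (a + k) ℤ.- G (b + k) ℤ.+ G k

  antidifference-step : ∀ k →
    ℤ.+ ((a + b + k) / m) ℤ.- ℤ.+ ((a + k) / m) ℤ.- ℤ.+ ((b + k) / m) ℤ.+ ℤ.+ (k / m)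
    ≡ antidifference (suc k) ℤ.- antidifference k
  antidifference-step k
    -- Moving `suc` outward lets each `floorSum` unfold by one increment.
    rewrite +-suc (a + b) k | +-suc a k | +-suc b k =
    cancel (ℤ.+ ((a + b + k) / m)) (ℤ.+ ((a + k) / m)) (ℤ.+ ((b + k) / m)) (ℤ.+ (k / m))
           (G (a + b + k)) (G (a + k)) (G (b + k)) (G k)
    where
    cancel : ∀ p q r s x y z w → p ℤ.- q ℤ.- r ℤ.+ s ≡
      ((p ℤ.+ x) ℤ.- (q ℤ.+ y) ℤ.- (r ℤ.+ z) ℤ.+ (s ℤ.+ w)) ℤ.- (x ℤ.- y ℤ.- z ℤ.+ w)
    cancel = solve-∀

  S≡antidifference : ∀ K → S m a b K ≡ antidifference (suc K) ℤ.- antidifference 0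
  S≡antidifference K = trans
    (sum-cong-≗ {suc K} (λ k → antidifference-step (toℕ k)))
    (sum-telescope antidifference (suc K))

  antidifference-0≤ : ∀ {n} → a ≤ m → b ≤ m → n ≤ m →
    antidifference 0 ≤ℤ antidifference n
  antidifference-0≤ {n} a≤m b≤m n≤m
    rewrite +-identityʳ (a + b) | +-identityʳ a | +-identityʳ b =
    ℤ.0≤i-j⇒j≤i (subst (0ℤ ≤ℤ_)
      (regroup (G (a + b + n)) (G (a + n)) (G (b + n)) (G n) (G (a + b)) (G a) (G b))
      -- The slack added on the right is `G n + G a + G b`, nonnegative because it is a natural
      -- number.
      (ℤ.i≤j⇒0≤j-i (ℤ.+≤+ (m≤n⇒m≤n+o _ (floorSum-pairs m a≤m b≤m n≤m)))))
    where
    regroup : ∀ x y z w p q r →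
      (x ℤ.+ (w ℤ.+ q ℤ.+ r)) ℤ.- (p ℤ.+ y ℤ.+ z)
      ≡ (x ℤ.- y ℤ.- z ℤ.+ w) ℤ.- (p ℤ.- q ℤ.- r ℤ.+ 0ℤ)
    regroup = solve-∀

theorem9 : (m : ℕ) .{{_ : NonZero m}} (a₁ a₂ K : ℕ) →
    a₁ ≤ m ∸ 1 → a₂ ≤ m ∸ 1 → K ≤ m ∸ 1 →
    0ℤ ≤ℤ S m a₁ a₂ K
theorem9 m@(suc _) a₁ a₂ K a₁<m a₂<m K<m =
  subst (0ℤ ≤ℤ_) (sym (S≡antidifference m a₁ a₂ K))
    -- The primitive is evaluated at `suc K`, which may equal `m`; this is why the bounds above are
    -- non-strict.
    (ℤ.i≤j⇒0≤j-i (antidifference-0≤ m a₁ a₂ (m≤n⇒m≤1+n a₁<m) (m≤n⇒m≤1+n a₂<m) (s≤s K<m)))
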